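{- A branching computon can always be constructed in $\mathbf{Set}^{\mathbf{Comp}}$; that is, every b-diagram has a colimit in $\mathbf{Set}^{\mathbf{Comp}}$.
   Context: $\mathbf{Set}$ is the category of finite sets and total functions. A computon $\lambda$ is a tuple $(U,P,I,O,\Sigma,\sigma,\tau,t,s,c)$ (a functor into $\mathbf{Set}$ from the free category on the arrows $\sigma:O\to U$, $\tau:I\to U$, $t:O\to P$, $s:I\to P$, $c:P\to\Sigma$) where $U$ (computation units), $I$ and $O$ (edges) are possibly empty finite sets, $P$ (ports) is a non-empty finite set, $\Sigma\subset\mathbb{N}$ (colours) is finite with $0\in\Sigma$, the functions $\sigma,\tau,c$ are surjective, and: the restrictions $\sigma|_{(c\circ t)^{ -1}(0)}$ and $\tau|_{(c\circ s)^{ -1}(0)}$ are surjective onto $U$; there is $p\in P\setminus \mathrm{Im}(s)$ with $c(p)=0$; there is $q\in P\setminus \mathrm{Im}(t)$ with $c(q)=0$. Components of $\lambda_j$ carry the subscript $j$. Put $P^+=P\setminus \mathrm{Im}(t)$ (e-inports) and $P^-=P\setminus \mathrm{Im}(s)$ (e-outports). Write $p\xrightarrow{i}u$ if $s(i)=p,\ \tau(i)=u$, and $u\xrightarrow{o}p$ if $\sigma(o)=u,\ t(o)=p$. For a port $p$, $\bullet p=\{u\in U\mid \exists o\in O,\ u\xrightarrow{o}p\}$ and $p\bullet=\{u\in U\mid\exists i\in I,\ p\xrightarrow{i}u\}$. Write $p_1\xrightarrow{\exists}p_n$ if there is a chain $p_1\xrightarrow{i_1}u_1\xrightarrow{o_1}p_2\cdots\xrightarrow{i_{n-1}}u_{n-1}\xrightarrow{o_{n-1}}p_n$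 with $n\ge 2$. A computon is connected if for each $p\in \mathrm{Im}(s)\cup P^+$ there is $q\in P^-$ with $p\xrightarrow{\exists}q$. A computon morphism $\alpha:\lambda_1\to\lambda_2$ is a natural transformation (functions $\alpha_U,\alpha_P,\alpha_I,\alpha_O,\alpha_\Sigma$ commuting with $\sigma,\tau,t,s,c$) such that $\alpha_\Sigma$ is the inclusion $\Sigma_1\subseteq\Sigma_2$ and $\vec{i}(\alpha)\cup\vec{o}(\alpha)\subseteq P_1^+\cup P_1^-$, where $\vec{i}(\alpha)=\{p\in P_1\mid \bullet\alpha(p)\setminus\alpha(\bullet p)\ne\emptyset\}$ and $\vec{o}(\alpha)=\{p\in P_1\mid \alpha(p)\bullet\setminus\alpha(p\bullet)\neq\emptyset\}$. Here $\alpha(p)=\alpha_P(p)$ and $\alpha(A)$ is the image of a set $A$ of ports or units. Computons and computon morphisms form the category $\mathbf{Set}^{\mathbf{Comp}}$ (componentwise composition). A trivial computon is one with $U=I=O=\emptyset$. An in-marker of a computon $\lambda$ is a computon monomorphism $\lambda^+:\lambda_0\to\lambda$ with $\lambda_0$ a trivial computon and $\lambda^+(P_0)=P^+$; an out-marker of $\lambda$ is a computon monomorphism $\lambda^-:\lambda_0\to\lambda$ with $\lambda_0$ trivial and $\lambda^-(P_0)=P^-$. A b-diagram is a diagram in $\mathbf{Set}^{\mathbf{Comp}}$ consisting of trivial computons $\lambda_0,\lambda_1$, connected computons $\lambda_2,\lambda_3$, in-markers $\lambda_2^+:\lambda_0\to\lambda_2$, $\lambda_3^+:\lambda_0\to\lambda_3$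 and out-markers $\lambda_2^-:\lambda_1\to\lambda_2$, $\lambda_3^-:\lambda_1\to\lambda_3$. A branching computon is the colimit of a b-diagram. -}

module Defs where

open import Data.Empty using (⊥-elim)
open import Data.Fin.Base using (Fin)
import Data.Fin.Properties as Fin
open import Data.List.Base using (List)
import Data.List.Membership.Propositional as List
import Data.List.Relation.Binary.Subset.Propositional as List
open import Data.Nat.Base using (ℕ)
open import Data.Product using (Σ; ∃; ∃!; _×_; _,_)
open import Data.Sum.Base using (inj₁; inj₂; [_,_]′)
open import Function.Base using (id; _∘_)
open import Function.Bundles using (_↔_; Inverse)
open import Function.Definitions using (Surjective)
open import Function.Properties.Inverse using (Inverse⇒Injection)
open import Level using (Level; 0ℓ; _⊔_) renaming (suc to lsuc)
open import Relation.Binary.Construct.Closure.Transitive using (TransClosure)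
open import Relation.Binary.Core using (Rel)
open import Relation.Binary.PropositionalEquality
  using (_≡_; _≗_; refl; sym; trans; cong)
open import Relation.Binary.Structures using (IsEquivalence)
open import Relation.Nullary.Decidable.Core using (Dec; yes; no)
import Relation.Nullary.Decidable as Dec
open import Relation.Nullary.Negation.Core using (¬_)
open import Relation.Unary using (Pred; _∈_; _⊆_; _≐_; _∪_; _∖_; ∁; Satisfiable)

private
  variable
    a o ℓ e o′ ℓ′ : Level

------------------------------------------------------------------------
-- Categories (with a setoid of morphisms) and colimits

record Category (o ℓ e : Level) : Set (lsuc (o ⊔ ℓ ⊔ e)) where
  infix  4 _⇒_ _≈_
  infixr 9 _⊚_
  field
    Obj : Set o
    _⇒_ : Obj → Obj → Set ℓ
    _≈_ : {A B : Obj} → Rel (A ⇒ B) e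
    ι   : {A : Obj} → A ⇒ A
    _⊚_ : {A B C : Obj} → B ⇒ C → A ⇒ B → A ⇒ C

    equiv     : {A B : Obj} → IsEquivalence (_≈_ {A} {B})
    ⊚-cong    : {A B C : Obj} {f g : B ⇒ C} {h k : A ⇒ B} →
                f ≈ g → h ≈ k → f ⊚ h ≈ g ⊚ k
    identityˡ : {A B : Obj} {f : A ⇒ B} → ι ⊚ f ≈ f
    identityʳ : {A B : Obj} {f : A ⇒ B} → f ⊚ ι ≈ f
    assoc     : {A B C D : Obj} {f : C ⇒ D} {g : B ⇒ C} {h : A ⇒ B} →
                (f ⊚ g) ⊚ h ≈ f ⊚ (g ⊚ h)

  Mono : {A B : Obj} → A ⇒ B → Set (o ⊔ ℓ ⊔ e)
  Mono {A} f = {C : Obj} (g h : C ⇒ A) → f ⊚ g ≈ f ⊚ h → g ≈ h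

-- The shape of a diagram is a directed graph: a diagram of shape J is a
-- functor out of the free category on J.

record Graph (o ℓ : Level) : Set (lsuc (o ⊔ ℓ)) where
  field
    Node : Set o
    Edge : Node → Node → Set ℓ

module _ (C : Category o ℓ e) (J : Graph o′ ℓ′) where
  open Category C
  open Graph J

  record Diagram : Set (o ⊔ ℓ ⊔ o′ ⊔ ℓ′) where
    field
      D₀ : Node → Obj
      D₁ : {j k : Node} → Edge j k → D₀ j ⇒ D₀ k

  module _ (D : Diagram) where
    open Diagram D

    record Cocone : Set (o ⊔ ℓ ⊔ e ⊔ o′ ⊔ ℓ′) where
      field
        apex     : Obj
        leg      : (j : Node) → D₀ j ⇒ apex
        commutes : {j k : Node} (x : Edge j k) → leg k ⊚ D₁ x ≈ leg j

    IsColimit : Cocone → Set (o ⊔ ℓ ⊔ e ⊔ o′ ⊔ ℓ′)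
    IsColimit L = (K : Cocone) →
      ∃! _≈_ λ (m : Cocone.apex L ⇒ Cocone.apex K) →
        (j : Node) → m ⊚ Cocone.leg L j ≈ Cocone.leg K j

    Colimit : Set (o ⊔ ℓ ⊔ e ⊔ o′ ⊔ ℓ′)
    Colimit = Σ Cocone IsColimit

------------------------------------------------------------------------
-- Finite sets and images

Finite : Set a → Set a
Finite A = ∃ λ n → A ↔ Fin n

Im : {A B : Set} → (A → B) → Pred B 0ℓ
Im f y = ∃ λ x → f x ≡ y

Image : {A B : Set} → (A → B) → Pred A 0ℓ → Pred B 0ℓ
Image f X y = ∃ λ x → x ∈ X × f x ≡ y

Im? : {A B : Set} → Finite A → Finite B →
      (f : A → B) (y : B) → Dec (y ∈ Im f)
Im? (m , A↔m) (n , B↔n) f y = Dec.map′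
  (λ (k , eq) → Inverse.from A↔m k , eq)
  (λ (x , eq) → Inverse.to A↔m x
              , trans (cong f (Inverse.strictlyInverseʳ A↔m x)) eq)
  (Fin.any? λ k →
    Dec.via-injection (Inverse⇒Injection B↔n) Fin._≟_
      (f (Inverse.from A↔m k)) y)

------------------------------------------------------------------------
-- Computons

record Computon : Set₁ where
  field
    U P I O : Set
    U-finite : Finite U
    P-finite : Finite P
    I-finite : Finite I
    O-finite : Finite O
    P-nonempty : P

    -- A finite subset of ℕ is given by a list of its elements; only
    -- membership in this list is ever used.
    colours  : List ℕ
    0∈colours : 0 List.∈ colours

    σ : O → U
    τ : I → U
    t : O → P
    s : I → P
    c : P → ℕ

    -- c is a function onto the set of colours.
    c-image : Im c ≐ (List._∈ colours)

    σ-surjective : Surjective _≡_ _≡_ σ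
    τ-surjective : Surjective _≡_ _≡_ τ

    σ-control : (u : U) → ∃ λ o → c (t o) ≡ 0 × σ o ≡ u
    τ-control : (u : U) → ∃ λ i → c (s i) ≡ 0 × τ i ≡ u

  P⁺ : Pred P 0ℓ
  P⁺ = ∁ (Im t)

  P⁻ : Pred P 0ℓ
  P⁻ = ∁ (Im s)

  field
    control-outport : ∃ λ p → p ∈ P⁻ × c p ≡ 0
    control-inport  : ∃ λ q → q ∈ P⁺ × c q ≡ 0

  infix 4 _-[_]→ᵤ_ _-[_]→ₚ_ _⟶_ _⟶∃_

  _-[_]→ᵤ_ : P → I → U → Set
  p -[ i ]→ᵤ u = s i ≡ p × τ i ≡ u

  _-[_]→ₚ_ : U → O → P → Set
  u -[ o ]→ₚ p = σ o ≡ u × t o ≡ p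

  •_ : P → Pred U 0ℓ
  (• p) u = ∃ λ o → u -[ o ]→ₚ p

  _• : P → Pred U 0ℓ
  (p •) u = ∃ λ i → p -[ i ]→ᵤ u

  _⟶_ : Rel P 0ℓ
  p ⟶ q = ∃ λ i → ∃ λ u → ∃ λ o → p -[ i ]→ᵤ u × u -[ o ]→ₚ q

  _⟶∃_ : Rel P 0ℓ
  _⟶∃_ = TransClosure _⟶_

  Connected : Set
  Connected = (p : P) → p ∈ Im s ∪ P⁺ → ∃ λ q → q ∈ P⁻ × p ⟶∃ q

  Trivial : Set
  Trivial = ¬ U × ¬ I × ¬ O

------------------------------------------------------------------------
-- Computon morphisms

record Morphism (A B : Computon) : Set where
  private
    module A = Computon A
    module B = Computon B

  field
    αU : A.U → B.U
    αP : A.P → B.P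
    αI : A.I → B.I
    αO : A.O → B.O

    -- The component at Σ is the inclusion, so it carries no data and
    -- naturality at c reads as an equation between natural numbers.
    αΣ : A.colours List.⊆ B.colours

    σ-natural : (o : A.O) → B.σ (αO o) ≡ αU (A.σ o)
    τ-natural : (i : A.I) → B.τ (αI i) ≡ αU (A.τ i)
    t-natural : (o : A.O) → B.t (αO o) ≡ αP (A.t o)
    s-natural : (i : A.I) → B.s (αI i) ≡ αP (A.s i)
    c-natural : (p : A.P) → B.c (αP p) ≡ A.c p

  i⃗ : Pred A.P 0ℓ
  i⃗ p = Satisfiable (B.•_ (αP p) ∖ Image αU (A.•_ p))

  o⃗ : Pred A.P 0ℓ
  o⃗ p = Satisfiable (B._• (αP p) ∖ Image αU (A._• p))

  field
    interface : i⃗ ∪ o⃗ ⊆ A.P⁺ ∪ A.P⁻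

infix 4 _≈_

record _≈_ {A B : Computon} (α β : Morphism A B) : Set where
  private
    module α = Morphism α
    module β = Morphism β
  field
    ≈U : α.αU ≗ β.αU
    ≈P : α.αP ≗ β.αP
    ≈I : α.αI ≗ β.αI
    ≈O : α.αO ≗ β.αO

identity : {A : Computon} → Morphism A A
identity = record
  { αU = id ; αP = id ; αI = id ; αO = id ; αΣ = id
  ; σ-natural = λ _ → refl ; τ-natural = λ _ → refl
  ; t-natural = λ _ → refl ; s-natural = λ _ → refl
  ; c-natural = λ _ → refl
  ; interface =
      [ (λ (u , u∈ , u∉) → ⊥-elim (u∉ (u , u∈ , refl)))
      , (λ (u , u∈ , u∉) → ⊥-elim (u∉ (u , u∈ , refl))) ]′
  }

infixr 9 _∙_

_∙_ : {A B C : Computon} → Morphism B C → Morphism A B → Morphism A C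
_∙_ {A} {B} {C} β α = record
  { αU = β.αU ∘ α.αU ; αP = β.αP ∘ α.αP
  ; αI = β.αI ∘ α.αI ; αO = β.αO ∘ α.αO
  ; αΣ = β.αΣ ∘ α.αΣ
  ; σ-natural = λ o → trans (β.σ-natural (α.αO o)) (cong β.αU (α.σ-natural o))
  ; τ-natural = λ i → trans (β.τ-natural (α.αI i)) (cong β.αU (α.τ-natural i))
  ; t-natural = λ o → trans (β.t-natural (α.αO o)) (cong β.αP (α.t-natural o))
  ; s-natural = λ i → trans (β.s-natural (α.αI i)) (cong β.αP (α.s-natural i))
  ; c-natural = λ p → trans (β.c-natural (α.αP p)) (α.c-natural p)
  ; interface = interface _
  }
  where
  module A = Computon A
  module B = Computon B
  module C = Computon C
  module α = Morphism α
  module β = Morphism β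

  i⃗∙ o⃗∙ : Pred A.P 0ℓ
  i⃗∙ p = Satisfiable
    (C.•_ (β.αP (α.αP p)) ∖ Image (β.αU ∘ α.αU) (A.•_ p))
  o⃗∙ p = Satisfiable
    (C._• (β.αP (α.αP p)) ∖ Image (β.αU ∘ α.αU) (A._• p))

  module _ (p : A.P) (p∈t : p ∈ Im A.t) (p∈s : p ∈ Im A.s) where

    inner : ¬ (p ∈ A.P⁺ ∪ A.P⁻)
    inner = [ (λ p∉t → p∉t p∈t) , (λ p∉s → p∉s p∈s) ]′

    inner′ : ¬ (α.αP p ∈ B.P⁺ ∪ B.P⁻)
    inner′ =
      [ (λ ∉t → let o , eq = p∈t in
          ∉t (α.αO o , trans (α.t-natural o) (cong α.αP eq)))
      , (λ ∉s → let i , eq = p∈s in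
          ∉s (α.αI i , trans (α.s-natural i) (cong α.αP eq))) ]′

    internal : ¬ (p ∈ i⃗∙ ∪ o⃗∙)
    internal (inj₁ (w , w∈ , w∉)) = inner′ (β.interface (inj₁ (w , w∈ ,
      λ (v , v∈ , βv≡w) → inner (α.interface (inj₁ (v , v∈ ,
        λ (u , u∈ , αu≡v) →
          w∉ (u , u∈ , trans (cong β.αU αu≡v) βv≡w)))))))
    internal (inj₂ (w , w∈ , w∉)) = inner′ (β.interface (inj₂ (w , w∈ ,
      λ (v , v∈ , βv≡w) → inner (α.interface (inj₂ (v , v∈ ,
        λ (u , u∈ , αu≡v) →
          w∉ (u , u∈ , trans (cong β.αU αu≡v) βv≡w)))))))

  interface : (p : A.P) → p ∈ i⃗∙ ∪ o⃗∙ → p ∈ A.P⁺ ∪ A.P⁻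
  interface p h
    with Im? A.O-finite A.P-finite A.t p | Im? A.I-finite A.P-finite A.s p
  ... | no p∉t  | _       = inj₁ p∉t
  ... | yes _   | no p∉s  = inj₂ p∉s
  ... | yes p∈t | yes p∈s = ⊥-elim (internal p p∈t p∈s h)

Set^Comp : Category (lsuc 0ℓ) 0ℓ 0ℓ
Set^Comp = record
  { Obj = Computon
  ; _⇒_ = Morphism
  ; _≈_ = _≈_
  ; ι   = identity
  ; _⊚_ = _∙_
  ; equiv = record
    { refl  = pointwise (λ _ → refl) (λ _ → refl) (λ _ → refl) (λ _ → refl)
    ; sym   = λ f → pointwise
        (sym ∘ ≈U f) (sym ∘ ≈P f) (sym ∘ ≈I f) (sym ∘ ≈O f)
    ; trans = λ f g → pointwise
        (λ x → trans (≈U f x) (≈U g x)) (λ x → trans (≈P f x) (≈P g x))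
        (λ x → trans (≈I f x) (≈I g x)) (λ x → trans (≈O f x) (≈O g x))
    }
  ; ⊚-cong = λ {_ _ _ f _ _ k} p q →
      let module f = Morphism f
          module k = Morphism k
      in pointwise
        (λ x → trans (cong f.αU (≈U q x)) (≈U p (k.αU x)))
        (λ x → trans (cong f.αP (≈P q x)) (≈P p (k.αP x)))
        (λ x → trans (cong f.αI (≈I q x)) (≈I p (k.αI x)))
        (λ x → trans (cong f.αO (≈O q x)) (≈O p (k.αO x)))
  ; identityˡ =
      pointwise (λ _ → refl) (λ _ → refl) (λ _ → refl) (λ _ → refl)
  ; identityʳ =
      pointwise (λ _ → refl) (λ _ → refl) (λ _ → refl) (λ _ → refl)
  ; assoc     =
      pointwise (λ _ → refl) (λ _ → refl) (λ _ → refl) (λ _ → refl)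
  }
  where
  open _≈_
  pointwise : {A B : Computon} {α β : Morphism A B} →
    let module α = Morphism α
        module β = Morphism β
    in α.αU ≗ β.αU → α.αP ≗ β.αP → α.αI ≗ β.αI → α.αO ≗ β.αO → α ≈ β
  pointwise u p i o = record { ≈U = u ; ≈P = p ; ≈I = i ; ≈O = o }

------------------------------------------------------------------------
-- Markers and b-diagrams

record IsInMarker {Λ₀ Λ : Computon} (α : Morphism Λ₀ Λ) : Set₁ where
  field
    trivial : Computon.Trivial Λ₀
    mono    : Category.Mono Set^Comp α
    image   : Im (Morphism.αP α) ≐ Computon.P⁺ Λ

record IsOutMarker {Λ₀ Λ : Computon} (α : Morphism Λ₀ Λ) : Set₁ where
  field
    trivial : Computon.Trivial Λ₀
    mono    : Category.Mono Set^Comp α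
    image   : Im (Morphism.αP α) ≐ Computon.P⁻ Λ

data Node : Set where
  n₀ n₁ n₂ n₃ : Node

data Edge : Node → Node → Set where
  in₂  : Edge n₀ n₂
  in₃  : Edge n₀ n₃
  out₂ : Edge n₁ n₂
  out₃ : Edge n₁ n₃

B-shape : Graph 0ℓ 0ℓ
B-shape = record { Node = Node ; Edge = Edge }

record BDiagram : Set₁ where
  field
    Λ₀ Λ₁ Λ₂ Λ₃ : Computon

    Λ₀-trivial   : Computon.Trivial Λ₀
    Λ₁-trivial   : Computon.Trivial Λ₁
    Λ₂-connected : Computon.Connected Λ₂
    Λ₃-connected : Computon.Connected Λ₃

    Λ₂⁺ : Morphism Λ₀ Λ₂
    Λ₃⁺ : Morphism Λ₀ Λ₃
    Λ₂⁻ : Morphism Λ₁ Λ₂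
    Λ₃⁻ : Morphism Λ₁ Λ₃

    Λ₂⁺-inMarker  : IsInMarker Λ₂⁺
    Λ₃⁺-inMarker  : IsInMarker Λ₃⁺
    Λ₂⁻-outMarker : IsOutMarker Λ₂⁻
    Λ₃⁻-outMarker : IsOutMarker Λ₃⁻

  diagram : Diagram Set^Comp B-shape
  diagram = record { D₀ = object ; D₁ = arrow }
    where
    object : Node → Computon
    object n₀ = Λ₀
    object n₁ = Λ₁
    object n₂ = Λ₂
    object n₃ = Λ₃

    arrow : {j k : Node} → Edge j k → Morphism (object j) (object k)
    arrow in₂  = Λ₂⁺
    arrow in₃  = Λ₃⁺
    arrow out₂ = Λ₂⁻
    arrow out₃ = Λ₃⁻

{-# OPTIONS --safe #-}

-- In a connected computon every e-inport has an outgoing edge, so e-inports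
-- and e-outports are disjoint.  As the ports of a trivial computon can be
-- moved independently, markers are injective on ports.  Hence Λ₀.P ⊎ Λ₁.P
-- embeds into the ports of both Λ₂ and Λ₃, and the colimit is the
-- componentwise pushout: units and edges are disjoint unions, and ports are
-- glued along these two embeddings.  The legs are jointly surjective on ports
-- and send interface ports to interface ports, so the interface condition of
-- the mediating morphism is inherited from the legs of the given cocone.

module Submission where

open import Defs

open import Data.Bool.Properties using (T-irrelevant)
open import Data.Empty using (⊥-elim)
open import Data.Fin.Base using (Fin; zero; suc)
import Data.Fin.Properties as Fin
open import Data.List.Base using (_++_)
open import Data.List.Membership.Propositional using () renaming (_∈_ to _∈ˡ_)
open import Data.List.Membership.Propositional.Properties
  using (∈-++⁺ˡ; ∈-++⁺ʳ; ∈-++⁻)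
open import Data.Nat.Base using (ℕ; zero; suc)
open import Data.Product using (Σ; ∃; _×_; _,_; proj₁; proj₂)
open import Data.Product.Function.Dependent.Propositional using (Σ-↔)
open import Data.Sum.Base as Sum using (_⊎_; inj₁; inj₂; [_,_]′)
open import Data.Sum.Function.Propositional using (_⊎-↔_)
open import Data.Sum.Properties using (inj₁-injective)
open import Function.Base using (id; _∘_)
open import Function.Bundles using (_↔_; mk↔ₛ′)
open import Function.Construct.Composition using (_↔-∘_)
open import Function.Construct.Identity using (↔-id)
open import Function.Construct.Symmetry using (↔-sym)
open import Function.Definitions using (Injective)
open import Function.Properties.Inverse using (Inverse⇒Injection)
open import Relation.Binary.Construct.Closure.Transitive using ([_]; _∷_)
open import Relation.Binary.Definitions using (DecidableEquality)
open import Relation.Binary.PropositionalEquality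
  using (_≡_; _≗_; refl; sym; trans; cong; subst)
open import Relation.Binary.Structures using (IsEquivalence)
open import Relation.Nullary.Decidable.Core
  using (Dec; yes; no; False; toWitnessFalse; fromWitnessFalse; decidable-stable)
import Relation.Nullary.Decidable as Dec
open import Relation.Unary using (_∈_; _∉_; _⊆_; _∪_; _∖_; Satisfiable)

-- Finite sets

module _ {A : Set} where

  Finite⇒≟ : Finite A → DecidableEquality A
  Finite⇒≟ (_ , A↔n) = Dec.via-injection (Inverse⇒Injection A↔n) Fin._≟_

  ↔-Finite : {B : Set} → A ↔ B → Finite B → Finite A
  ↔-Finite A↔B (n , B↔n) = n , B↔n ↔-∘ A↔B

  ⊎-Finite : {B : Set} → Finite A → Finite B → Finite (A ⊎ B)
  ⊎-Finite (m , A↔m) (n , B↔n) =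
    _ , ↔-sym (Fin.+↔⊎ {m} {n}) ↔-∘ (A↔m ⊎-↔ B↔n)

  False-Finite : (A? : Dec A) → Finite (False A?)
  False-Finite (yes _) = 0 , ↔-sym Fin.0↔⊥
  False-Finite (no _)  = 1 , ↔-sym Fin.1↔⊤

Σ-Fin-Finite : ∀ n {Q : Fin n → Set} → (∀ k → Finite (Q k)) → Finite (Σ (Fin n) Q)
Σ-Fin-Finite zero    _     = 0 , mk↔ₛ′ (λ ()) (λ ()) (λ ()) (λ ())
Σ-Fin-Finite (suc n) Q-fin = ↔-Finite
  (mk↔ₛ′ (λ { (zero , q) → inj₁ q ; (suc k , q) → inj₂ (k , q) })
         [ zero ,_ , (λ (k , q) → suc k , q) ]′
         (λ { (inj₁ _) → refl ; (inj₂ _) → refl })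
         (λ { (zero , _) → refl ; (suc _ , _) → refl }))
  (⊎-Finite (Q-fin zero) (Σ-Fin-Finite n (Q-fin ∘ suc)))

Σ-Finite : {A : Set} {Q : A → Set} →
           Finite A → (∀ a → Finite (Q a)) → Finite (Σ A Q)
Σ-Finite (n , A↔n) Q-fin =
  ↔-Finite (↔-sym (Σ-↔ (↔-sym A↔n) (↔-id _))) (Σ-Fin-Finite n (Q-fin ∘ _))

-- Pushouts of injections of finite sets

module Pushout {S A B : Set} (S-fin : Finite S) (A-fin : Finite A) (B-fin : Finite B)
  (f : S → A) (f-inj : Injective _≡_ _≡_ f)
  (g : S → B) (g-inj : Injective _≡_ _≡_ g) where

  private
    g? : (b : B) → Dec (b ∈ Im g)
    g? = Im? S-fin B-fin g

  -- All of `A`, plus the points of `B` outside the image of `g`, so that no quotient is formed.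
  -- `False (g? b)` stands for non-membership because its inhabitants are equal without function
  -- extensionality: each free `b` contributes exactly one point.
  Carrier : Set
  Carrier = A ⊎ Σ B λ b → False (g? b)

  Carrier-finite : Finite Carrier
  Carrier-finite = ⊎-Finite A-fin (Σ-Finite B-fin (False-Finite ∘ g?))

  inl : A → Carrier
  inl = inj₁

  -- The decision is a separate argument so that facts about `inr` can be proved for an arbitrary
  -- decision, by cases in the helpers `go`.
  place : (b : B) → Dec (b ∈ Im g) → Carrier
  place b (yes (x , _)) = inj₁ (f x)
  place b (no b∉)       = inj₂ (b , fromWitnessFalse b∉)

  inr : B → Carrier
  inr b = place b (g? b)

  inr-glued : ∀ x → inr (g x) ≡ inl (f x)
  inr-glued x = go (g? (g x))
    where
    go : ∀ d → place (g x) d ≡ inl (f x)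
    -- The preimage that the decision finds need not be `x` itself; injectivity of `g` identifies
    -- the two.
    go (yes (_ , gy≡gx)) = cong (inj₁ ∘ f) (g-inj gy≡gx)
    go (no gx∉)          = ⊥-elim (gx∉ (x , refl))

  inr-free : ∀ {b} (b∉ : False (g? b)) → inr b ≡ inj₂ (b , b∉)
  inr-free {b} b∉ = go (g? b)
    where
    go : ∀ d → place b d ≡ inj₂ (b , b∉)
    go (yes b∈) = ⊥-elim (toWitnessFalse b∉ b∈)
    go (no _)   = cong (λ z → inj₂ (b , z)) (T-irrelevant _ _)

  cover : ∀ p → p ∈ Im inl ∪ Im inr
  cover (inj₁ a)        = inj₁ (a , refl)
  cover (inj₂ (b , b∉)) = inj₂ (b , inr-free b∉)

  -- The pushout square is also a pullback: `inr b` lies in the left summand only when `b` was found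
  -- in the image of `g`, and that preimage is the witness.
  inl≡inr : ∀ {a b} → inl a ≡ inr b → ∃ λ x → f x ≡ a × g x ≡ b
  inl≡inr {a} {b} = go (g? b)
    where
    go : ∀ d → inl a ≡ place b d → ∃ λ x → f x ≡ a × g x ≡ b
    go (yes (x , gx≡b)) a≡fx = x , sym (inj₁-injective a≡fx) , gx≡b

  inr-injective : Injective _≡_ _≡_ inr
  inr-injective {b} {b′} = go (g? b) (g? b′)
    where
    go : ∀ d d′ → place b d ≡ place b′ d′ → b ≡ b′
    go (yes (x , gx≡b)) (yes (y , gy≡b′)) fx≡fy =
      trans (sym gx≡b) (trans (cong g (f-inj (inj₁-injective fx≡fy))) gy≡b′)
    go (no _) (no _) refl = refl

  module _ {X : Set} (h : A → X) (k : B → X) (h∘f≗k∘g : h ∘ f ≗ k ∘ g) where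

    rec : Carrier → X
    rec = [ h , k ∘ proj₁ ]′

    rec-inr : rec ∘ inr ≗ k
    rec-inr b = go (g? b)
      where
      go : ∀ d → rec (place b d) ≡ k b
      go (yes (x , gx≡b)) = trans (h∘f≗k∘g x) (cong k gx≡b)
      go (no _)           = refl

  module _ {X : Set} {h k : Carrier → X} where

    rec-unique : h ∘ inl ≗ k ∘ inl → h ∘ inr ≗ k ∘ inr → h ≗ k
    rec-unique inl≗ inr≗ p with cover p
    ... | inj₁ (a , refl) = inl≗ a
    ... | inj₂ (b , refl) = inr≗ b

  module _ {X Y : Set} {h : X → A} {k : Y → B} where

    -- Gluing can bring a point of `A` into the image only through a point hit by `k`. By `inl≡inr`
    -- such a point is shared, and the hypothesis returns it to the image of `h`. This controls
    -- which ports keep their e-inport or e-outport status.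
    Im-inl : (∀ x → g x ∈ Im k → f x ∈ Im h) →
             ∀ {a} → inl a ∈ Im [ inl ∘ h , inr ∘ k ]′ → a ∈ Im h
    Im-inl _   (inj₁ x , eq) = x , inj₁-injective eq
    Im-inl g⇒f (inj₂ y , eq) with inl≡inr (sym eq)
    ... | z , refl , gz≡ky = g⇒f z (y , sym gz≡ky)

    Im-inr : (∀ x → f x ∈ Im h → g x ∈ Im k) →
             ∀ {b} → inr b ∈ Im [ inl ∘ h , inr ∘ k ]′ → b ∈ Im k
    Im-inr f⇒g (inj₁ x , eq) with inl≡inr eq
    ... | z , fz≡hx , refl = f⇒g z (x , sym fz≡hx)
    Im-inr _   (inj₂ y , eq) = y , inr-injective eq

-- Markers

from-trivial : {A B : Computon} → Computon.Trivial A → {α β : Morphism A B} →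
               Morphism.αP α ≗ Morphism.αP β → α ≈ β
from-trivial (¬U , ¬I , ¬O) αP≗βP = record
  { ≈U = ⊥-elim ∘ ¬U ; ≈P = αP≗βP ; ≈I = ⊥-elim ∘ ¬I ; ≈O = ⊥-elim ∘ ¬O }

module _ {Λ₀ Λ : Computon} (trivial : Computon.Trivial Λ₀) (α : Morphism Λ₀ Λ) where
  open Computon Λ₀
  open Morphism α

  private
    _≟_ : DecidableEquality P
    _≟_ = Finite⇒≟ P-finite

    replace : P → P → P → P
    replace x y p = [ (λ _ → y) , (λ _ → p) ]′ (Dec.toSum (p ≟ x))

    replace-preserves : {Q : Set} (h : P → Q) {x y : P} → h x ≡ h y →
                        h ∘ replace x y ≗ h
    replace-preserves h {x} hx≡hy p with p ≟ x
    ... | yes refl = sym hx≡hy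
    ... | no _     = refl

    replace-self : ∀ x y → replace x y x ≡ y
    replace-self x y with x ≟ x
    ... | yes _  = refl
    ... | no x≢x = ⊥-elim (x≢x refl)

    -- Without edges, any colour-preserving self-map of the ports is a morphism; the interface
    -- condition holds because every port is an e-inport.
    replacement : (x y : P) → c x ≡ c y → Morphism Λ₀ Λ₀
    replacement x y cx≡cy = record
      { αU = id ; αP = replace x y ; αI = id ; αO = id ; αΣ = id
      ; σ-natural = λ _ → refl
      ; τ-natural = λ _ → refl
      ; t-natural = λ o → let _ , _ , ¬O = trivial in ⊥-elim (¬O o)
      ; s-natural = λ i → let _ , ¬I , _ = trivial in ⊥-elim (¬I i)
      ; c-natural = replace-preserves c cx≡cy
      ; interface = λ _ → let _ , _ , ¬O = trivial in inj₁ λ (o , _) → ¬O o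
      }

  -- If `α` identifies `x` and `y`, it cannot tell the identity from the replacement of `x` by `y`;
  -- cancelling `α` and evaluating at `x` gives `x ≡ y`. The replacement is available since `α`
  -- preserves colours.
  trivial-mono⇒injective : Category.Mono Set^Comp α → Injective _≡_ _≡_ αP
  trivial-mono⇒injective mono {x} {y} αx≡αy =
    trans (_≈_.≈P (mono identity (replacement x y cx≡cy) agree) x) (replace-self x y)
    where
    cx≡cy : c x ≡ c y
    cx≡cy = trans (sym (c-natural x)) (trans (cong (Computon.c Λ) αx≡αy) (c-natural y))

    agree : (α ∙ identity) ≈ (α ∙ replacement x y cx≡cy)
    agree = record
      { ≈U = λ _ → refl
      ; ≈P = sym ∘ replace-preserves αP αx≡αy
      ; ≈I = λ _ → refl
      ; ≈O = λ _ → refl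
      }

-- Ports of connected computons and their markers

module _ (Λ : Computon) (connected : Computon.Connected Λ) where
  open Computon Λ

  -- A chain has at least one step, and its first edge leaves `p`.
  P⁺⊆Im-s : P⁺ ⊆ Im s
  P⁺⊆Im-s {p} p∈P⁺ with connected p (inj₂ p∈P⁺)
  ... | _ , _ , [ i , _ , _ , (si≡p , _) , _ ]     = i , si≡p
  ... | _ , _ , ((i , _ , _ , (si≡p , _) , _) ∷ _) = i , si≡p

  -- A port outside the image of `t` is an e-inport, hence has an outgoing edge and is no e-outport.
  -- Decidability of the image removes the double negation.
  P⁻⊆Im-t : P⁻ ⊆ Im t
  P⁻⊆Im-t p∈P⁻ = decidable-stable (Im? O-finite P-finite t _) (p∈P⁻ ∘ P⁺⊆Im-s)

module Boundary {Λ₀ Λ₁ Λ : Computon} (connected : Computon.Connected Λ)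
  {α⁺ : Morphism Λ₀ Λ} (in-marker : IsInMarker α⁺)
  {α⁻ : Morphism Λ₁ Λ} (out-marker : IsOutMarker α⁻) where

  open Computon Λ
  private
    module + = IsInMarker in-marker
    module - = IsOutMarker out-marker

  boundary : Computon.P Λ₀ ⊎ Computon.P Λ₁ → P
  boundary = [ Morphism.αP α⁺ , Morphism.αP α⁻ ]′

  boundary⁺ : ∀ x → boundary (inj₁ x) ∈ P⁺
  boundary⁺ x = proj₁ +.image (x , refl)

  boundary⁻ : ∀ y → boundary (inj₂ y) ∈ P⁻
  boundary⁻ y = proj₁ -.image (y , refl)

  boundary-interface : ∀ x → boundary x ∈ P⁺ ∪ P⁻
  boundary-interface (inj₁ x) = inj₁ (boundary⁺ x)
  boundary-interface (inj₂ y) = inj₂ (boundary⁻ y)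

  boundary-injective : Injective _≡_ _≡_ boundary
  boundary-injective {inj₁ _} {inj₁ _} eq =
    cong inj₁ (trivial-mono⇒injective +.trivial α⁺ +.mono eq)
  boundary-injective {inj₂ _} {inj₂ _} eq =
    cong inj₂ (trivial-mono⇒injective -.trivial α⁻ -.mono eq)
  boundary-injective {inj₁ x} {inj₂ y} eq =
    ⊥-elim (boundary⁻ y (subst (Im s) eq (P⁺⊆Im-s Λ connected (boundary⁺ x))))
  boundary-injective {inj₂ y} {inj₁ x} eq =
    ⊥-elim (boundary⁻ y (subst (Im s) (sym eq) (P⁺⊆Im-s Λ connected (boundary⁺ x))))

-- The glued computon

module Branching (B : BDiagram) where
  open BDiagram B

  private
    module Λ₀ = Computon Λ₀
    module Λ₁ = Computon Λ₁
    module Λ₂ = Computon Λ₂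
    module Λ₃ = Computon Λ₃
    module ∂₂ = Boundary Λ₂-connected Λ₂⁺-inMarker Λ₂⁻-outMarker
    module ∂₃ = Boundary Λ₃-connected Λ₃⁺-inMarker Λ₃⁻-outMarker

  open Pushout (⊎-Finite Λ₀.P-finite Λ₁.P-finite) Λ₂.P-finite Λ₃.P-finite
    ∂₂.boundary ∂₂.boundary-injective ∂₃.boundary ∂₃.boundary-injective

  t : Λ₂.O ⊎ Λ₃.O → Carrier
  t = [ inl ∘ Λ₂.t , inr ∘ Λ₃.t ]′

  s : Λ₂.I ⊎ Λ₃.I → Carrier
  s = [ inl ∘ Λ₂.s , inr ∘ Λ₃.s ]′

  c-glued : Λ₂.c ∘ ∂₂.boundary ≗ Λ₃.c ∘ ∂₃.boundary
  c-glued (inj₁ x) = trans (Morphism.c-natural Λ₂⁺ x) (sym (Morphism.c-natural Λ₃⁺ x))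
  c-glued (inj₂ y) = trans (Morphism.c-natural Λ₂⁻ y) (sym (Morphism.c-natural Λ₃⁻ y))

  c : Carrier → ℕ
  c = rec Λ₂.c Λ₃.c c-glued

  c-inr : c ∘ inr ≗ Λ₃.c
  c-inr = rec-inr Λ₂.c Λ₃.c c-glued

  -- At a port shared through the in-markers the other side has no incoming edge either; at one
  -- shared through the out-markers connectedness already gives an incoming edge on this side. The
  -- next three facts are the mirror images.
  inl-P⁺ : ∀ {p} → p ∈ Λ₂.P⁺ → inl p ∉ Im t
  inl-P⁺ p∈ = p∈ ∘ Im-inl λ where
    (inj₁ x) ∈t → ⊥-elim (∂₃.boundary⁺ x ∈t)
    (inj₂ y) _  → P⁻⊆Im-t Λ₂ Λ₂-connected (∂₂.boundary⁻ y)

  inl-P⁻ : ∀ {p} → p ∈ Λ₂.P⁻ → inl p ∉ Im s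
  inl-P⁻ p∈ = p∈ ∘ Im-inl λ where
    (inj₁ x) _  → P⁺⊆Im-s Λ₂ Λ₂-connected (∂₂.boundary⁺ x)
    (inj₂ y) ∈s → ⊥-elim (∂₃.boundary⁻ y ∈s)

  inr-P⁺ : ∀ {p} → p ∈ Λ₃.P⁺ → inr p ∉ Im t
  inr-P⁺ p∈ = p∈ ∘ Im-inr λ where
    (inj₁ x) ∈t → ⊥-elim (∂₂.boundary⁺ x ∈t)
    (inj₂ y) _  → P⁻⊆Im-t Λ₃ Λ₃-connected (∂₃.boundary⁻ y)

  inr-P⁻ : ∀ {p} → p ∈ Λ₃.P⁻ → inr p ∉ Im s
  inr-P⁻ p∈ = p∈ ∘ Im-inr λ where
    (inj₁ x) _  → P⁺⊆Im-s Λ₃ Λ₃-connected (∂₃.boundary⁺ x)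
    (inj₂ y) ∈s → ⊥-elim (∂₂.boundary⁻ y ∈s)

  σ-control : ∀ u → ∃ λ o → c (t o) ≡ 0 × Sum.map Λ₂.σ Λ₃.σ o ≡ u
  σ-control (inj₁ u) = let o , co≡0 , σo≡u = Λ₂.σ-control u in
    inj₁ o , co≡0 , cong inj₁ σo≡u
  σ-control (inj₂ u) = let o , co≡0 , σo≡u = Λ₃.σ-control u in
    inj₂ o , trans (c-inr (Λ₃.t o)) co≡0 , cong inj₂ σo≡u

  τ-control : ∀ u → ∃ λ i → c (s i) ≡ 0 × Sum.map Λ₂.τ Λ₃.τ i ≡ u
  τ-control (inj₁ u) = let i , ci≡0 , τi≡u = Λ₂.τ-control u in
    inj₁ i , ci≡0 , cong inj₁ τi≡u
  τ-control (inj₂ u) = let i , ci≡0 , τi≡u = Λ₃.τ-control u in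
    inj₂ i , trans (c-inr (Λ₃.s i)) ci≡0 , cong inj₂ τi≡u

  Im-c⊆colours : ∀ {n} → n ∈ Im c → n ∈ˡ (Λ₂.colours ++ Λ₃.colours)
  Im-c⊆colours (inj₁ p , eq)       = ∈-++⁺ˡ (proj₁ Λ₂.c-image (p , eq))
  Im-c⊆colours (inj₂ (p , _) , eq) = ∈-++⁺ʳ Λ₂.colours (proj₁ Λ₃.c-image (p , eq))

  colours⊆Im-c : ∀ {n} → n ∈ˡ (Λ₂.colours ++ Λ₃.colours) → n ∈ Im c
  colours⊆Im-c n∈ with ∈-++⁻ Λ₂.colours n∈
  ... | inj₁ n∈₂ = let p , eq = proj₂ Λ₂.c-image n∈₂ in inl p , eq
  ... | inj₂ n∈₃ = let p , eq = proj₂ Λ₃.c-image n∈₃ in inr p , trans (c-inr p) eq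

  branching : Computon
  branching = record
    { U = Λ₂.U ⊎ Λ₃.U ; P = Carrier ; I = Λ₂.I ⊎ Λ₃.I ; O = Λ₂.O ⊎ Λ₃.O
    ; U-finite = ⊎-Finite Λ₂.U-finite Λ₃.U-finite
    ; P-finite = Carrier-finite
    ; I-finite = ⊎-Finite Λ₂.I-finite Λ₃.I-finite
    ; O-finite = ⊎-Finite Λ₂.O-finite Λ₃.O-finite
    ; P-nonempty = inl Λ₂.P-nonempty
    ; colours = Λ₂.colours ++ Λ₃.colours
    ; 0∈colours = ∈-++⁺ˡ Λ₂.0∈colours
    ; σ = Sum.map Λ₂.σ Λ₃.σ ; τ = Sum.map Λ₂.τ Λ₃.τ ; t = t ; s = s ; c = c
    ; c-image = Im-c⊆colours , colours⊆Im-c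
    ; σ-surjective = λ u → let o , _ , eq = σ-control u in o , λ { refl → eq }
    ; τ-surjective = λ u → let i , _ , eq = τ-control u in i , λ { refl → eq }
    ; σ-control = σ-control
    ; τ-control = τ-control
    ; control-outport = let p , p∈ , cp≡0 = Λ₂.control-outport in
        inl p , inl-P⁻ p∈ , cp≡0
    ; control-inport = let q , q∈ , cq≡0 = Λ₂.control-inport in
        inl q , inl-P⁺ q∈ , cq≡0
    }

  private
    module Λ = Computon branching

  -- The legs and the cocone

  inl-interface : ∀ {p} → p ∈ Λ₂.P⁺ ∪ Λ₂.P⁻ → inl p ∈ Λ.P⁺ ∪ Λ.P⁻
  inl-interface = Sum.map inl-P⁺ inl-P⁻

  inr-interface : ∀ {p} → p ∈ Λ₃.P⁺ ∪ Λ₃.P⁻ → inr p ∈ Λ.P⁺ ∪ Λ.P⁻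
  inr-interface = Sum.map inr-P⁺ inr-P⁻

  shared-interface : ∀ {p q} → inl p ≡ inr q →
                     p ∈ Λ₂.P⁺ ∪ Λ₂.P⁻ × q ∈ Λ₃.P⁺ ∪ Λ₃.P⁻
  shared-interface eq with inl≡inr eq
  ... | x , refl , refl = ∂₂.boundary-interface x , ∂₃.boundary-interface x

  leg₂ : Morphism Λ₂ branching
  leg₂ = record
    { αU = inj₁ ; αP = inl ; αI = inj₁ ; αO = inj₁
    ; αΣ = ∈-++⁺ˡ
    ; σ-natural = λ _ → refl ; τ-natural = λ _ → refl
    ; t-natural = λ _ → refl ; s-natural = λ _ → refl
    ; c-natural = λ _ → refl
    ; interface = λ where
        -- An edge of `Λ₂` brings no new unit to the port. An edge of `Λ₃` can reach it only if the
        -- port is shared, and shared ports are interface ports.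
        (inj₁ (_ , (inj₁ o , refl , to≡p) , u∉)) →
          ⊥-elim (u∉ (_ , (o , refl , inj₁-injective to≡p) , refl))
        (inj₁ (_ , (inj₂ _ , _ , to≡p) , _)) → proj₁ (shared-interface (sym to≡p))
        (inj₂ (_ , (inj₁ i , si≡p , refl) , u∉)) →
          ⊥-elim (u∉ (_ , (i , inj₁-injective si≡p , refl) , refl))
        (inj₂ (_ , (inj₂ _ , si≡p , _) , _)) → proj₁ (shared-interface (sym si≡p))
    }

  leg₃ : Morphism Λ₃ branching
  leg₃ = record
    { αU = inj₂ ; αP = inr ; αI = inj₂ ; αO = inj₂
    ; αΣ = ∈-++⁺ʳ Λ₂.colours
    ; σ-natural = λ _ → refl ; τ-natural = λ _ → refl
    ; t-natural = λ _ → refl ; s-natural = λ _ → refl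
    ; c-natural = c-inr
    ; interface = λ where
        (inj₁ (_ , (inj₂ o , refl , to≡p) , u∉)) →
          ⊥-elim (u∉ (_ , (o , refl , inr-injective to≡p) , refl))
        (inj₁ (_ , (inj₁ _ , _ , to≡p) , _)) → proj₂ (shared-interface to≡p)
        (inj₂ (_ , (inj₂ i , si≡p , refl) , u∉)) →
          ⊥-elim (u∉ (_ , (i , inr-injective si≡p , refl) , refl))
        (inj₂ (_ , (inj₁ _ , si≡p , _) , _)) → proj₂ (shared-interface si≡p)
    }

  cocone : Cocone Set^Comp B-shape diagram
  cocone = record
    { apex = branching
    -- The legs at `n₀` and `n₁` pass through `Λ₂`, so the triangles of `in₂` and `out₂` commute by
    -- definition; those of `in₃` and `out₃` use the gluing.
    ; leg = λ where
        n₀ → leg₂ ∙ Λ₂⁺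
        n₁ → leg₂ ∙ Λ₂⁻
        n₂ → leg₂
        n₃ → leg₃
    ; commutes = λ where
        in₂  → IsEquivalence.refl (Category.equiv Set^Comp)
        out₂ → IsEquivalence.refl (Category.equiv Set^Comp)
        in₃  → from-trivial Λ₀-trivial (inr-glued ∘ inj₁)
        out₃ → from-trivial Λ₁-trivial (inr-glued ∘ inj₂)
    }

  -- The universal property

  module _ (K : Cocone Set^Comp B-shape diagram) where
    open Cocone K

    private
      module K = Computon apex
      module k₂ = Morphism (leg n₂)
      module k₃ = Morphism (leg n₃)

    legs-glued : k₂.αP ∘ ∂₂.boundary ≗ k₃.αP ∘ ∂₃.boundary
    legs-glued (inj₁ x) = trans (_≈_.≈P (commutes in₂) x) (sym (_≈_.≈P (commutes in₃) x))
    legs-glued (inj₂ y) = trans (_≈_.≈P (commutes out₂) y) (sym (_≈_.≈P (commutes out₃) y))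

    mP : Carrier → K.P
    mP = rec k₂.αP k₃.αP legs-glued

    mP-inr : mP ∘ inr ≗ k₃.αP
    mP-inr = rec-inr k₂.αP k₃.αP legs-glued

    mU : Λ.U → K.U
    mU = [ k₂.αU , k₃.αU ]′

    -- Every port is the image of some `q` in `Λ₂` or `Λ₃`. Edges at `q` persist after gluing, so a
    -- unit missed by `mU` at `p` is missed by the leg at `q`, whose interface condition applies.
    -- The type unfolds `i⃗ ∪ o⃗` because the morphism they belong to is still being built.
    m-interface : ∀ p →
      Satisfiable (K.•_ (mP p) ∖ Image mU (Λ.•_ p)) ⊎
      Satisfiable (K._• (mP p) ∖ Image mU (Λ._• p)) →
      p ∈ Λ.P⁺ ∪ Λ.P⁻
    m-interface p p∈ with cover p
    m-interface _ (inj₁ (w , w∈ , w∉)) | inj₁ (q , refl) =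
      inl-interface (k₂.interface (inj₁ (w , w∈ ,
        λ { (_ , (o , refl , refl) , eq) → w∉ (_ , (inj₁ o , refl , refl) , eq) })))
    m-interface _ (inj₂ (w , w∈ , w∉)) | inj₁ (q , refl) =
      inl-interface (k₂.interface (inj₂ (w , w∈ ,
        λ { (_ , (i , refl , refl) , eq) → w∉ (_ , (inj₁ i , refl , refl) , eq) })))
    -- Unlike on `inl`, `mP` agrees with the leg on `inr` only propositionally, hence the transport.
    m-interface _ (inj₁ (w , w∈ , w∉)) | inj₂ (q , refl) =
      inr-interface (k₃.interface (inj₁ (w , subst (λ r → (K.• r) w) (mP-inr q) w∈ ,
        λ { (_ , (o , refl , refl) , eq) → w∉ (_ , (inj₂ o , refl , refl) , eq) })))
    m-interface _ (inj₂ (w , w∈ , w∉)) | inj₂ (q , refl) =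
      inr-interface (k₃.interface (inj₂ (w , subst (λ r → (r K.•) w) (mP-inr q) w∈ ,
        λ { (_ , (i , refl , refl) , eq) → w∉ (_ , (inj₂ i , refl , refl) , eq) })))

    mediator : Morphism branching apex
    mediator = record
      { αU = mU ; αP = mP
      ; αI = [ k₂.αI , k₃.αI ]′ ; αO = [ k₂.αO , k₃.αO ]′
      ; αΣ = [ k₂.αΣ , k₃.αΣ ]′ ∘ ∈-++⁻ Λ₂.colours
      ; σ-natural = Sum.[ k₂.σ-natural , k₃.σ-natural ]
      ; τ-natural = Sum.[ k₂.τ-natural , k₃.τ-natural ]
      ; t-natural = Sum.[ k₂.t-natural
                        , (λ o → trans (k₃.t-natural o) (sym (mP-inr (Λ₃.t o)))) ]
      ; s-natural = Sum.[ k₂.s-natural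
                        , (λ i → trans (k₃.s-natural i) (sym (mP-inr (Λ₃.s i)))) ]
      ; c-natural = Sum.[ k₂.c-natural , k₃.c-natural ∘ proj₁ ]
      ; interface = m-interface _
      }

    mediates : ∀ j → (mediator ∙ Cocone.leg cocone j) ≈ leg j
    mediates n₀ = from-trivial Λ₀-trivial (_≈_.≈P (commutes in₂))
    mediates n₁ = from-trivial Λ₁-trivial (_≈_.≈P (commutes out₂))
    mediates n₂ = record
      { ≈U = λ _ → refl ; ≈P = λ _ → refl ; ≈I = λ _ → refl ; ≈O = λ _ → refl }
    mediates n₃ = record
      { ≈U = λ _ → refl ; ≈P = mP-inr ; ≈I = λ _ → refl ; ≈O = λ _ → refl }

    -- The legs at `n₂` and `n₃` are jointly surjective on every component, so agreement after
    -- composing with these two suffices.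
    mediator-unique : {n : Morphism branching apex} →
                      (∀ j → (n ∙ Cocone.leg cocone j) ≈ leg j) → mediator ≈ n
    mediator-unique n-mediates = record
      { ≈U = Sum.[ ≈U on₂ , ≈U on₃ ]
      ; ≈P = rec-unique (≈P on₂) (≈P on₃)
      ; ≈I = Sum.[ ≈I on₂ , ≈I on₃ ]
      ; ≈O = Sum.[ ≈O on₂ , ≈O on₃ ]
      }
      where
      open _≈_
      agree : ∀ j → (mediator ∙ Cocone.leg cocone j) ≈ (_ ∙ Cocone.leg cocone j)
      agree j = IsEquivalence.trans (Category.equiv Set^Comp) (mediates j)
        (IsEquivalence.sym (Category.equiv Set^Comp) (n-mediates j))
      on₂ = agree n₂
      on₃ = agree n₃

lemma3 : (B : BDiagram) → Colimit Set^Comp B-shape (BDiagram.diagram B)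
lemma3 B = cocone , λ K → mediator K , mediates K , mediator-unique K
  where open Branching B
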